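{- Let $d\geqslant 1$ and $i$ be integers with $0\leqslant i\leqslant d$. Then \[D_{d,i}=2^{\frac{d(d-1)}{2}-i}\binom{d}{i}\frac{d+i}{d}.\]
   Context: For natural integers $a_1,\dots,a_d$ and $b_1,\dots,b_d$, the binomial determinant $\binom{a_1,\dots,a_d}{b_1,\dots,b_d}$ is the $d\times d$ determinant $\det\left(\binom{a_r}{b_s}\right)_{1\leqslant r,s\leqslant d}$ (with $\binom{a}{b}=0$ if $b>a$). For $0\leqslant i\leqslant d$, $D_{d,i}$ is the binomial determinant with top row $(d-1,d,\dots,d-2+i,d+i,\dots,2d-1)$ — i.e. the integers from $d-1$ to $2d-1$ in increasing order with $d-1+i$ omitted — and bottom row $(0,2,4,\dots,2(d-1))$. -}

module Defs where

open import Data.Nat using (ℕ; zero; suc; _+_; _∸_; _*_; _<_)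
open import Data.Nat.Combinatorics using (_C_)
open import Data.Integer as ℤ using (ℤ; +_; -_)
open import Data.Fin using (Fin; zero; suc; toℕ; punchIn)
open import Data.Bool using (if_then_else_)
open import Data.Nat using (_<ᵇ_)

binom : ℕ → ℕ → ℕ
binom a b = if a <ᵇ b then 0 else a C b

det : (n : ℕ) → (Fin n → Fin n → ℤ) → ℤ
det zero M = + 1
det (suc n) M = go (suc n) (λ j → j)
  where
  sgn : ℕ → ℤ
  sgn k = if Data.Nat._≡ᵇ_ (k Data.Nat.% 2) 0 then + 1 else - (+ 1)
  minor : Fin (suc n) → Fin n → Fin n → ℤ
  minor j r s = M (suc r) (punchIn j s)
  go : (k : ℕ) → (Fin k → Fin (suc n)) → ℤ
  go zero f = ℤ.0ℤ
  go (suc k) f = sgn (toℕ (f zero)) ℤ.* M zero (f zero) ℤ.* det n (minor (f zero))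
                 ℤ.+ go k (λ x → f (suc x))

binomDet : (d : ℕ) → (Fin d → ℕ) → (Fin d → ℕ) → ℤ
binomDet d a b = det d (λ r s → + binom (a r) (b s))

-- top row of D_{d,i}: integers d-1, ..., 2d-1 increasing, with d-1+i omitted
-- entry r (0-based) is d-1+r if r < i, else d+r
topRow : (d i : ℕ) → Fin d → ℕ
topRow d i r = if toℕ r <ᵇ i then (d ∸ 1) + toℕ r else d + toℕ r

bottomRow : (d : ℕ) → Fin d → ℕ
bottomRow d s = 2 * toℕ s

D : (d i : ℕ) → ℤ
D d i = binomDet d (topRow d i) (bottomRow d)

{-# OPTIONS --safe #-}
module Submission where

-- Let R₀, …, R_d be the rows (C(d-1+j, 2s))_{0 ≤ s < d}, so that D_{d,i} is the minor that omits R_i.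
-- If Σ c_j R_j = 0, then c_i D_{d,i+1} + c_{i+1} D_{d,i} = 0: put Σ c_j R_j in row i of the minor that
-- omits R_{i+1} and expand; only the terms j = i and j = i+1 have no repeated row.
-- The coefficients of P(x) = (1-x)(2-x)^(d-1) are such a relation: Σ c_j C(d-1+j, b) is the coefficient
-- of y^b in x^(d-1) P(x) at x = 1+y, which is the odd polynomial -y (1-y²)^(d-1).
-- This gives D_{d,i} = |c_i / c_0| D_{d,0}. The last column of D_{d,d} is (0, …, 0, 1), hence
-- D_{d,d} = D_{d-1,0} and D_{d,0} = 2^(d-1) D_{d-1,0}.

open import Defs
open import Data.Bool using (T; true; false; if_then_else_)
open import Data.Empty using (⊥-elim)
open import Data.Fin using (Fin; zero; suc; toℕ; punchIn; inject₁; fromℕ; fromℕ<)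
open import Data.Fin.Properties using (punchInᵢ≢i; toℕ<n; toℕ-fromℕ; toℕ-inject₁; toℕ-fromℕ<)
open import Data.Integer as ℤ using (ℤ; +_; -_; 0ℤ)
open import Data.Integer.Properties as ℤₚ using ()
open import Data.Integer.Tactic.RingSolver using (solve-∀)
open import Data.Nat as ℕ using (ℕ; zero; suc; _+_; _*_; _^_; _∸_; _/_; _≤_; _<_; z≤n; s≤s)
open import Data.Nat.Combinatorics using (_C_; nC1≡n; nCn≡1; k>n⇒nCk≡0; nCk+nC[k+1]≡[n+1]C[k+1])
open import Data.Nat.Divisibility using (divides-refl)
open import Data.Nat.DivMod using (m*n/n≡m; +-distrib-/-∣ʳ)
open import Data.Nat.Properties as ℕₚ using ()
open import Data.Nat.Tactic.RingSolver as ℕ-Solver using ()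
open import Data.Product using (Σ; _,_; proj₁)
open import Data.Unit using (tt)
open import Data.Vec.Functional using (updateAt)
open import Data.Vec.Functional.Properties using (updateAt-updates; updateAt-minimal)
open import Function using (_∘_; const)
open import Relation.Binary.PropositionalEquality using (_≡_; _≢_; _≗_; refl; sym; trans; cong; cong₂; subst; ≢-sym; module ≡-Reasoning)
open import Algebra.Properties.Semiring.Sum ℤₚ.+-*-semiring using (sum; sum-cong-≗; sum-remove; *-distribˡ-sum; *-distribʳ-sum)
open ≡-Reasoning

-- Determinants

Matrix : ℕ → Set
Matrix n = Fin n → Fin n → ℤ

-- `minor` and `sgn` repeat local definitions of `det`, so that they agree with its unfolding by
-- computation.
minor : ∀ {n} → Matrix (suc n) → Fin (suc n) → Matrix n
minor M j r s = M (suc r) (punchIn j s)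

sgn : ℕ → ℤ
sgn k = if k ℕ.% 2 ℕ.≡ᵇ 0 then + 1 else - (+ 1)

sgn-suc : ∀ k → sgn (suc k) ≡ - sgn k
sgn-suc zero = refl
sgn-suc (suc zero) = refl
sgn-suc (suc (suc k)) = sgn-suc k

laplaceTerm : ∀ n → Matrix (suc n) → Fin (suc n) → ℤ
laplaceTerm n M j = sgn (toℕ j) ℤ.* M zero j ℤ.* det n (minor M j)

laplaceSum : ∀ n → Matrix (suc n) → (k : ℕ) → (Fin k → Fin (suc n)) → ℤ
laplaceSum n M zero f = 0ℤ
laplaceSum n M (suc k) f = laplaceTerm n M (f zero) ℤ.+ laplaceSum n M k (λ x → f (suc x))

-- The local function go of det has no name here. It does occur in the normal form of the tail below,
-- and abstracting suc n, M and the index map there leaves go applied to distinct variables, from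
-- which unification finds the left-hand side `_` of go≡laplaceSum.
detTail : ∀ n M → Σ ℤ λ t → det (suc (suc n)) M ≡
  laplaceTerm (suc n) M zero ℤ.+ (laplaceTerm (suc n) M (suc zero) ℤ.+ t)
detTail n M = _ , refl

mutual
  go≡laplaceSum : ∀ n M k f → _ ≡ laplaceSum n M k f
  go≡laplaceSum n M zero f = refl
  go≡laplaceSum n M (suc k) f =
    cong (λ t → laplaceTerm n M (f zero) ℤ.+ t) (go≡laplaceSum n M k (λ x → f (suc x)))

  detTail≡laplaceSum : ∀ n M → proj₁ (detTail n M) ≡ laplaceSum (suc n) M n (λ x → suc (suc x))
  detTail≡laplaceSum n M with suc n | M | (λ (x : Fin n) → Fin.suc (Fin.suc x))
  ... | m | N | f = go≡laplaceSum m N n f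

-- Nested subtraction g 0 - (g 1 - (g 2 - ...)) produces the alternating signs without `sgn`, so
-- Laplace expansions can be treated by plain recursion on the columns.
alt : ∀ n → (Fin n → ℤ) → ℤ
alt zero g = 0ℤ
alt (suc n) g = g zero ℤ.- alt n (g ∘ suc)

alt-cong : ∀ n {g h : Fin n → ℤ} → g ≗ h → alt n g ≡ alt n h
alt-cong zero eq = refl
alt-cong (suc n) eq = cong₂ ℤ._-_ (eq zero) (alt-cong n (eq ∘ suc))

alt-zero : ∀ n {g : Fin n → ℤ} → (∀ j → g j ≡ 0ℤ) → alt n g ≡ 0ℤ
alt-zero zero eq = refl
alt-zero (suc n) eq = cong₂ ℤ._-_ (eq zero) (alt-zero n (eq ∘ suc))

alt-scale : ∀ n a (g : Fin n → ℤ) → alt n (λ j → a ℤ.* g j) ≡ a ℤ.* alt n g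
alt-scale zero a g = sym (ℤₚ.*-zeroʳ a)
alt-scale (suc n) a g = begin
  a ℤ.* g zero ℤ.- alt n (λ j → a ℤ.* g (suc j)) ≡⟨ cong (λ t → a ℤ.* g zero ℤ.- t) (alt-scale n a (g ∘ suc)) ⟩
  a ℤ.* g zero ℤ.- a ℤ.* alt n (g ∘ suc)         ≡⟨ lemma a (g zero) (alt n (g ∘ suc)) ⟩
  a ℤ.* (g zero ℤ.- alt n (g ∘ suc))             ∎
  where
  lemma : ∀ a x y → a ℤ.* x ℤ.- a ℤ.* y ≡ a ℤ.* (x ℤ.- y)
  lemma = solve-∀

alt-+ : ∀ n (g h : Fin n → ℤ) → alt n (λ j → g j ℤ.+ h j) ≡ alt n g ℤ.+ alt n h
alt-+ zero g h = refl
alt-+ (suc n) g h = begin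
  g zero ℤ.+ h zero ℤ.- alt n (λ j → g (suc j) ℤ.+ h (suc j)) ≡⟨ cong (λ t → g zero ℤ.+ h zero ℤ.- t) (alt-+ n (g ∘ suc) (h ∘ suc)) ⟩
  g zero ℤ.+ h zero ℤ.- (alt n (g ∘ suc) ℤ.+ alt n (h ∘ suc)) ≡⟨ lemma (g zero) (h zero) (alt n (g ∘ suc)) (alt n (h ∘ suc)) ⟩
  alt (suc n) g ℤ.+ alt (suc n) h                             ∎
  where
  lemma : ∀ a b x y → a ℤ.+ b ℤ.- (x ℤ.+ y) ≡ (a ℤ.- x) ℤ.+ (b ℤ.- y)
  lemma = solve-∀

alt-sum : ∀ n {k} (c : Fin k → ℤ) (X : Fin k → Fin n → ℤ) →
  alt n (λ s → sum (λ j → c j ℤ.* X j s)) ≡ sum (λ j → c j ℤ.* alt n (X j))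
alt-sum n {zero} c X = alt-zero n (λ _ → refl)
alt-sum n {suc k} c X = begin
  alt n (λ s → c zero ℤ.* X zero s ℤ.+ sum (λ j → c (suc j) ℤ.* X (suc j) s))             ≡⟨ alt-+ n _ _ ⟩
  alt n (λ s → c zero ℤ.* X zero s) ℤ.+ alt n (λ s → sum (λ j → c (suc j) ℤ.* X (suc j) s))
    ≡⟨ cong₂ ℤ._+_ (alt-scale n (c zero) (X zero)) (alt-sum n (c ∘ suc) (X ∘ suc)) ⟩
  sum (λ j → c j ℤ.* alt n (X j))                                                          ∎

alt-init : ∀ n (g : Fin (suc n) → ℤ) → g (fromℕ n) ≡ 0ℤ → alt (suc n) g ≡ alt n (g ∘ inject₁)
alt-init zero g eq = cong (ℤ._- 0ℤ) eq
alt-init (suc n) g eq = cong (λ t → g zero ℤ.- t) (alt-init n (g ∘ suc) eq)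

-- The recursion passes to tails of the list of columns, hence the offset `o`: its sign factors out,
-- and each further column flips it.
laplaceSum≡alt : ∀ n M k (f : Fin k → Fin (suc n)) o → (∀ x → toℕ (f x) ≡ o ℕ.+ toℕ x) →
  laplaceSum n M k f ≡ sgn o ℤ.* alt k (λ x → M zero (f x) ℤ.* det n (minor M (f x)))
laplaceSum≡alt n M zero f o eq = sym (ℤₚ.*-zeroʳ (sgn o))
laplaceSum≡alt n M (suc k) f o eq = begin
  sgn (toℕ (f zero)) ℤ.* a ℤ.* b ℤ.+ laplaceSum n M k (f ∘ suc)
    ≡⟨ cong₂ (λ p t → sgn p ℤ.* a ℤ.* b ℤ.+ t) (trans (eq zero) (ℕₚ.+-identityʳ o))
         (laplaceSum≡alt n M k (f ∘ suc) (suc o) (λ x → trans (eq (suc x)) (ℕₚ.+-suc o (toℕ x)))) ⟩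
  sgn o ℤ.* a ℤ.* b ℤ.+ sgn (suc o) ℤ.* rest ≡⟨ cong (λ t → sgn o ℤ.* a ℤ.* b ℤ.+ t ℤ.* rest) (sgn-suc o) ⟩
  sgn o ℤ.* a ℤ.* b ℤ.+ (- sgn o) ℤ.* rest   ≡⟨ lemma (sgn o) a b rest ⟩
  sgn o ℤ.* (a ℤ.* b ℤ.- rest)               ∎
  where
  a = M zero (f zero)
  b = det n (minor M (f zero))
  rest = alt k (λ x → M zero (f (suc x)) ℤ.* det n (minor M (f (suc x))))
  lemma : ∀ s a b t → s ℤ.* a ℤ.* b ℤ.+ (- s) ℤ.* t ≡ s ℤ.* (a ℤ.* b ℤ.- t)
  lemma = solve-∀

det-laplace : ∀ n (M : Matrix (suc n)) →
  det (suc n) M ≡ alt (suc n) (λ j → M zero j ℤ.* det n (minor M j))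
det-laplace n M = begin
  det (suc n) M                         ≡⟨ go≡laplaceSum n M (suc n) (λ j → j) ⟩
  laplaceSum n M (suc n) (λ j → j)      ≡⟨ laplaceSum≡alt n M (suc n) (λ j → j) 0 (λ _ → refl) ⟩
  + 1 ℤ.* alt (suc n) (λ j → M zero j ℤ.* det n (minor M j)) ≡⟨ ℤₚ.*-identityˡ _ ⟩
  alt (suc n) (λ j → M zero j ℤ.* det n (minor M j)) ∎

det-cong : ∀ n {M N : Matrix n} → (∀ r s → M r s ≡ N r s) → det n M ≡ det n N
det-cong zero eq = refl
det-cong (suc n) {M} {N} eq = begin
  det (suc n) M                                      ≡⟨ det-laplace n M ⟩
  alt (suc n) (λ j → M zero j ℤ.* det n (minor M j)) ≡⟨ alt-cong (suc n) (λ j → cong₂ ℤ._*_ (eq zero j) (det-cong n (λ r s → eq (suc r) (punchIn j s)))) ⟩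
  alt (suc n) (λ j → N zero j ℤ.* det n (minor N j)) ≡⟨ sym (det-laplace n N) ⟩
  det (suc n) N                                      ∎

-- Row replacement and linearity in one row

_[_]≔_ : ∀ {m} {A : Set} → (Fin m → A) → Fin m → A → Fin m → A
M [ i ]≔ v = updateAt M i (const v)

update-∘ : ∀ {m} {A B : Set} (f : A → B) (M : Fin m → A) i v r → f ((M [ i ]≔ v) r) ≡ ((f ∘ M) [ i ]≔ f v) r
update-∘ f M zero v zero = refl
update-∘ f M zero v (suc r) = refl
update-∘ f M (suc i) v zero = refl
update-∘ f M (suc i) v (suc r) = update-∘ f (M ∘ suc) i v r

minor-update : ∀ {n} (M : Matrix (suc n)) i v j r s →
  minor (M [ suc i ]≔ v) j r s ≡ (minor M j [ i ]≔ (v ∘ punchIn j)) r s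
minor-update M i v j r s = cong (λ row → row s) (update-∘ (_∘ punchIn j) (M ∘ suc) i v r)

sum-*ʳ : ∀ {k} (a : ℤ) (c x : Fin k → ℤ) →
  sum (λ j → c j ℤ.* x j) ℤ.* a ≡ sum (λ j → c j ℤ.* (x j ℤ.* a))
sum-*ʳ a c x = trans (*-distribʳ-sum a (λ j → c j ℤ.* x j)) (sum-cong-≗ (λ j → ℤₚ.*-assoc (c j) (x j) a))

sum-*ˡ : ∀ {k} (a : ℤ) (c x : Fin k → ℤ) →
  a ℤ.* sum (λ j → c j ℤ.* x j) ≡ sum (λ j → c j ℤ.* (a ℤ.* x j))
sum-*ˡ a c x = trans (*-distribˡ-sum a (λ j → c j ℤ.* x j)) (sum-cong-≗ (λ j → lemma a (c j) (x j)))
  where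
  lemma : ∀ a c x → a ℤ.* (c ℤ.* x) ≡ c ℤ.* (a ℤ.* x)
  lemma = solve-∀

-- Row 0 enters the Laplace expansion linearly. For a later row, every minor carries the replacement
-- in its own row `i`, and induction applies.
det-linear : ∀ n (M : Matrix n) i {k} (c : Fin k → ℤ) (R : Fin k → Fin n → ℤ) →
  det n (M [ i ]≔ (λ s → sum (λ j → c j ℤ.* R j s))) ≡ sum (λ j → c j ℤ.* det n (M [ i ]≔ R j))
det-linear (suc n) M zero c R = begin
  det (suc n) (M [ zero ]≔ (λ s → sum (λ j → c j ℤ.* R j s)))
    ≡⟨ det-laplace n (M [ zero ]≔ (λ s → sum (λ j → c j ℤ.* R j s))) ⟩
  alt (suc n) (λ s → sum (λ j → c j ℤ.* R j s) ℤ.* det n (minor M s))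
    ≡⟨ alt-cong (suc n) (λ s → sum-*ʳ (det n (minor M s)) c (λ j → R j s)) ⟩
  alt (suc n) (λ s → sum (λ j → c j ℤ.* (R j s ℤ.* det n (minor M s))))
    ≡⟨ alt-sum (suc n) c (λ j s → R j s ℤ.* det n (minor M s)) ⟩
  sum (λ j → c j ℤ.* alt (suc n) (λ s → R j s ℤ.* det n (minor M s)))
    ≡⟨ sum-cong-≗ (λ j → cong (c j ℤ.*_) (sym (det-laplace n (M [ zero ]≔ R j)))) ⟩
  sum (λ j → c j ℤ.* det (suc n) (M [ zero ]≔ R j)) ∎
det-linear (suc n) M (suc i) c R = begin
  det (suc n) (M [ suc i ]≔ v)
    ≡⟨ det-laplace n (M [ suc i ]≔ v) ⟩
  alt (suc n) (λ s → M zero s ℤ.* det n (minor (M [ suc i ]≔ v) s))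
    ≡⟨ alt-cong (suc n) (λ s → cong (M zero s ℤ.*_) (trans (det-cong n (minor-update M i v s)) (det-linear n (minor M s) i c (λ j → R j ∘ punchIn s)))) ⟩
  alt (suc n) (λ s → M zero s ℤ.* sum (λ j → c j ℤ.* minorDet j s))
    ≡⟨ alt-cong (suc n) (λ s → sum-*ˡ (M zero s) c (λ j → minorDet j s)) ⟩
  alt (suc n) (λ s → sum (λ j → c j ℤ.* (M zero s ℤ.* minorDet j s)))
    ≡⟨ alt-sum (suc n) c (λ j s → M zero s ℤ.* minorDet j s) ⟩
  sum (λ j → c j ℤ.* alt (suc n) (λ s → M zero s ℤ.* minorDet j s))
    ≡⟨ sum-cong-≗ (λ j → cong (c j ℤ.*_) (trans
         (alt-cong (suc n) (λ s → cong (M zero s ℤ.*_) (sym (det-cong n (minor-update M i (R j) s)))))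
         (sym (det-laplace n (M [ suc i ]≔ R j))))) ⟩
  sum (λ j → c j ℤ.* det (suc n) (M [ suc i ]≔ R j)) ∎
  where
  v = λ s → sum (λ j → c j ℤ.* R j s)
  minorDet = λ j s → det n (minor M s [ i ]≔ (R j ∘ punchIn s))

-- The zero row is the empty linear combination.
det-zeroRow : ∀ n (M : Matrix n) i → det n (M [ i ]≔ const 0ℤ) ≡ 0ℤ
det-zeroRow n M i = det-linear n M i {0} (λ ()) (λ ())

-- Antisymmetry and equal rows

lift : ∀ {m n} → (Fin m → Fin n) → Fin (suc m) → Fin (suc n)
lift h zero = zero
lift h (suc x) = suc (h x)

-- Column embeddings reached by different routes agree only pointwise, so functions of them must
-- respect pointwise equality.
Extensional : ∀ {m n} → ((Fin m → Fin n) → ℤ) → Set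
Extensional G = ∀ {g h} → g ≗ h → G g ≡ G h

-- Laplace expansion along two rows `u` and `v`. The embedding of the remaining columns is passed to
-- `G`, which stands for the complementary minor.
alt₂ : ∀ n → (u v : Fin (suc (suc n)) → ℤ) → ((Fin n → Fin (suc (suc n))) → ℤ) → ℤ
alt₂ n u v G = alt (suc (suc n)) (λ j → u j ℤ.* alt (suc n) (λ l → v (punchIn j l) ℤ.* G (punchIn j ∘ punchIn l)))

alt₁ : ∀ n → (Fin (suc (suc n)) → ℤ) → ((Fin n → Fin (suc (suc n))) → ℤ) → ℤ
alt₁ n u G = alt (suc n) (λ l → u (suc l) ℤ.* G (suc ∘ punchIn l))

-- Splitting off column 0 in both expansions; the part without column 0 has the same shape again.
alt₂-peel : ∀ n u v G (K : Fin (suc n) → ℤ) →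
  (∀ j → alt n (λ l → v (suc (punchIn j l)) ℤ.* G (punchIn (suc j) ∘ punchIn (suc l))) ≡ K j) →
  alt₂ n u v G ≡ u zero ℤ.* alt₁ n v G ℤ.- v zero ℤ.* alt₁ n u G ℤ.+ alt (suc n) (λ j → u (suc j) ℤ.* K j)
alt₂-peel n u v G K eq = begin
  a ℤ.- alt (suc n) (λ j → u (suc j) ℤ.* (v zero ℤ.* G′ j ℤ.- K′ j))
    ≡⟨ cong (λ t → a ℤ.- t) (alt-cong (suc n) (λ j → trans
         (cong (λ t → u (suc j) ℤ.* (v zero ℤ.* G′ j ℤ.- t)) (eq j))
         (distribute (u (suc j)) (v zero) (G′ j) (K j)))) ⟩
  a ℤ.- alt (suc n) (λ j → v zero ℤ.* (u (suc j) ℤ.* G′ j) ℤ.+ - + 1 ℤ.* (u (suc j) ℤ.* K j))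
    ≡⟨ cong (λ t → a ℤ.- t) (trans (alt-+ (suc n) (λ j → v zero ℤ.* uG j) (λ j → - + 1 ℤ.* uK j))
         (cong₂ ℤ._+_ (alt-scale (suc n) (v zero) uG) (alt-scale (suc n) (- + 1) uK))) ⟩
  a ℤ.- (v zero ℤ.* alt₁ n u G ℤ.+ - + 1 ℤ.* b)
    ≡⟨ regroup a (v zero ℤ.* alt₁ n u G) b ⟩
  a ℤ.- v zero ℤ.* alt₁ n u G ℤ.+ b ∎
  where
  a = u zero ℤ.* alt₁ n v G
  G′ = λ j → G (suc ∘ punchIn j)
  K′ = λ j → alt n (λ l → v (suc (punchIn j l)) ℤ.* G (punchIn (suc j) ∘ punchIn (suc l)))
  uG = λ j → u (suc j) ℤ.* G′ j
  uK = λ j → u (suc j) ℤ.* K j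
  b = alt (suc n) uK
  distribute : ∀ x y g k → x ℤ.* (y ℤ.* g ℤ.- k) ≡ y ℤ.* (x ℤ.* g) ℤ.+ - + 1 ℤ.* (x ℤ.* k)
  distribute = solve-∀
  regroup : ∀ a x b → a ℤ.- (x ℤ.+ - + 1 ℤ.* b) ≡ a ℤ.- x ℤ.+ b
  regroup = solve-∀

punchIn-lift : ∀ {n} (j : Fin (suc (suc n))) (l : Fin (suc n)) →
  punchIn (suc j) ∘ punchIn (suc l) ≗ lift (punchIn j ∘ punchIn l)
punchIn-lift j l zero = refl
punchIn-lift j l (suc x) = refl

-- Induction on the number of columns. The terms in which `u` or `v` uses column 0 change places
-- with opposite signs under the swap; in the others column 0 stays in the minor, which turns `G`
-- into `G ∘ lift`.
alt₂-anticomm : ∀ n u v G → Extensional G → alt₂ n u v G ≡ - alt₂ n v u G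
-- Both embeddings have empty domain, so the two values of `G` coincide and a 2 by 2 determinant
-- remains.
alt₂-anticomm zero u v G ext = lemma (u zero) (u (suc zero)) (v zero) (v (suc zero)) _ _ (ext (λ ()))
  where
  expand : ∀ u₀ u₁ v₀ v₁ g →
    u₀ ℤ.* (v₁ ℤ.* g ℤ.- 0ℤ) ℤ.- (u₁ ℤ.* (v₀ ℤ.* g ℤ.- 0ℤ) ℤ.- 0ℤ) ≡
    - (v₀ ℤ.* (u₁ ℤ.* g ℤ.- 0ℤ) ℤ.- (v₁ ℤ.* (u₀ ℤ.* g ℤ.- 0ℤ) ℤ.- 0ℤ))
  expand = solve-∀
  lemma : ∀ u₀ u₁ v₀ v₁ g h → g ≡ h →
    u₀ ℤ.* (v₁ ℤ.* g ℤ.- 0ℤ) ℤ.- (u₁ ℤ.* (v₀ ℤ.* h ℤ.- 0ℤ) ℤ.- 0ℤ) ≡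
    - (v₀ ℤ.* (u₁ ℤ.* g ℤ.- 0ℤ) ℤ.- (v₁ ℤ.* (u₀ ℤ.* h ℤ.- 0ℤ) ℤ.- 0ℤ))
  lemma u₀ u₁ v₀ v₁ g .g refl = expand u₀ u₁ v₀ v₁ g
alt₂-anticomm (suc n) u v G ext = begin
  alt₂ (suc n) u v G ≡⟨ peel u v ⟩
  a ℤ.- b ℤ.+ alt₂ n (u ∘ suc) (v ∘ suc) (G ∘ lift)
    ≡⟨ cong (λ t → a ℤ.- b ℤ.+ t) (alt₂-anticomm n (u ∘ suc) (v ∘ suc) (G ∘ lift) ext-lift) ⟩
  a ℤ.- b ℤ.+ - alt₂ n (v ∘ suc) (u ∘ suc) (G ∘ lift) ≡⟨ lemma a b _ ⟩
  - (b ℤ.- a ℤ.+ alt₂ n (v ∘ suc) (u ∘ suc) (G ∘ lift)) ≡⟨ cong -_ (sym (peel v u)) ⟩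
  - alt₂ (suc n) v u G ∎
  where
  a = u zero ℤ.* alt₁ (suc n) v G
  b = v zero ℤ.* alt₁ (suc n) u G
  peel : ∀ u v → alt₂ (suc n) u v G ≡ u zero ℤ.* alt₁ (suc n) v G ℤ.- v zero ℤ.* alt₁ (suc n) u G
                                      ℤ.+ alt₂ n (u ∘ suc) (v ∘ suc) (G ∘ lift)
  peel u v = alt₂-peel (suc n) u v G _ λ j → alt-cong (suc n) λ l →
    cong (v (suc (punchIn j l)) ℤ.*_) (ext (punchIn-lift j l))
  ext-lift : Extensional (G ∘ lift)
  ext-lift eq = ext λ where
    zero → refl
    (suc x) → cong suc (eq x)
  lemma : ∀ a b x → a ℤ.- b ℤ.+ - x ≡ - (b ℤ.- a ℤ.+ x)
  lemma = solve-∀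

swap₀₁ : ∀ {n} {A : Set} → (Fin (suc (suc n)) → A) → Fin (suc (suc n)) → A
swap₀₁ M zero = M (suc zero)
swap₀₁ M (suc zero) = M zero
swap₀₁ M (suc (suc r)) = M (suc (suc r))

det-alt₂ : ∀ n (M : Matrix (suc (suc n))) →
  det (suc (suc n)) M ≡ alt₂ n (M zero) (M (suc zero)) (λ h → det n (λ r → M (suc (suc r)) ∘ h))
det-alt₂ n M = trans (det-laplace (suc n) M)
  (alt-cong (suc (suc n)) (λ j → cong (M zero j ℤ.*_) (det-laplace n (minor M j))))

det-swap : ∀ n (M : Matrix (suc (suc n))) → det (suc (suc n)) M ≡ - det (suc (suc n)) (swap₀₁ M)
det-swap n M = begin
  det (suc (suc n)) M                ≡⟨ det-alt₂ n M ⟩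
  alt₂ n (M zero) (M (suc zero)) G   ≡⟨ alt₂-anticomm n (M zero) (M (suc zero)) G ext ⟩
  - alt₂ n (M (suc zero)) (M zero) G ≡⟨ cong -_ (sym (det-alt₂ n (swap₀₁ M))) ⟩
  - det (suc (suc n)) (swap₀₁ M)     ∎
  where
  G : (Fin n → Fin (suc (suc n))) → ℤ
  G h = det n (λ r → M (suc (suc r)) ∘ h)
  ext : Extensional G
  ext eq = det-cong n (λ r s → cong (M (suc (suc r))) (eq s))

i≡-i⇒i≡0 : ∀ i → i ≡ - i → i ≡ 0ℤ
i≡-i⇒i≡0 (+ zero) eq = refl

Alternating : ℕ → Set
Alternating n = ∀ (M : Matrix n) r s → r ≢ s → M r ≗ M s → det n M ≡ 0ℤ

det-equalRows-suc : ∀ {n} → Alternating n → ∀ (M : Matrix (suc n)) r s → r ≢ s →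
  M (suc r) ≗ M (suc s) → det (suc n) M ≡ 0ℤ
det-equalRows-suc {n} alternating M r s r≢s eq = trans (det-laplace n M) (alt-zero (suc n) λ j →
  trans (cong (M zero j ℤ.*_) (alternating (minor M j) r s r≢s (eq ∘ punchIn j))) (ℤₚ.*-zeroʳ (M zero j)))

-- If rows 0 and 1 agree, swapping them gives det = - det. Otherwise the swap moves row 0 to
-- position 1, both equal rows then lie below row 0, and expansion along row 0 applies.
det-equalRows-zero : ∀ {n} → Alternating n → ∀ (M : Matrix (suc n)) s → M zero ≗ M (suc s) → det (suc n) M ≡ 0ℤ
det-equalRows-zero {suc n} alternating M zero eq =
  i≡-i⇒i≡0 _ (trans (det-swap n M) (cong -_ (det-cong (suc (suc n)) swapped)))
  where
  swapped : ∀ r s → swap₀₁ M r s ≡ M r s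
  swapped zero s = sym (eq s)
  swapped (suc zero) s = eq s
  swapped (suc (suc r)) s = refl
det-equalRows-zero {suc n} alternating M (suc s) eq =
  trans (det-swap n M) (cong -_ (det-equalRows-suc alternating (swap₀₁ M) zero (suc s) (λ ()) eq))

det-alternating : ∀ n → Alternating n
det-alternating (suc n) M zero zero r≢s eq = ⊥-elim (r≢s refl)
det-alternating (suc n) M zero (suc s) r≢s eq = det-equalRows-zero (det-alternating n) M s eq
det-alternating (suc n) M (suc r) zero r≢s eq = det-equalRows-zero (det-alternating n) M r (sym ∘ eq)
det-alternating (suc n) M (suc r) (suc s) r≢s eq =
  det-equalRows-suc (det-alternating n) M r s (r≢s ∘ cong suc) eq

-- Adjacent maximal minors under a linear relation

punchIn-suc-self : ∀ {n} (i : Fin n) → punchIn (suc i) i ≡ inject₁ i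
punchIn-suc-self zero = refl
punchIn-suc-self (suc i) = cong suc (punchIn-suc-self i)

update-self : ∀ {m} {A : Set} (M : Fin m → A) i r → (M [ i ]≔ M i) r ≡ M r
update-self M zero zero = refl
update-self M zero (suc r) = refl
update-self M (suc i) zero = refl
update-self M (suc i) (suc r) = update-self (M ∘ suc) i r

-- Overwriting row i by row i+1 in the family that omits row i+1 leaves the rows in increasing
-- order, so the passage between adjacent minors costs no sign.
update-punchIn : ∀ {m} {A : Set} (R : Fin (suc m) → A) i r →
  ((R ∘ punchIn (suc i)) [ i ]≔ R (suc i)) r ≡ R (punchIn (inject₁ i) r)
update-punchIn R zero zero = refl
update-punchIn R zero (suc r) = refl
update-punchIn R (suc i) zero = refl
update-punchIn R (suc i) (suc r) = update-punchIn (R ∘ suc) i r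

sum-zero : ∀ k {t : Fin k → ℤ} → (∀ j → t j ≡ 0ℤ) → sum t ≡ 0ℤ
sum-zero zero eq = refl
sum-zero (suc k) eq = cong₂ ℤ._+_ (eq zero) (sum-zero k (eq ∘ suc))

adjacentMinors : ∀ n (R : Fin (suc (suc n)) → Fin (suc n) → ℤ) (c : Fin (suc (suc n)) → ℤ) →
  (∀ s → sum (λ j → c j ℤ.* R j s) ≡ 0ℤ) → ∀ i →
  c (suc i) ℤ.* det (suc n) (R ∘ punchIn (inject₁ i)) ℤ.+ c (inject₁ i) ℤ.* det (suc n) (R ∘ punchIn (suc i)) ≡ 0ℤ
adjacentMinors n R c relation i = begin
  c (suc i) ℤ.* det (suc n) (R ∘ punchIn (inject₁ i)) ℤ.+ c (inject₁ i) ℤ.* det (suc n) M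
    ≡⟨ cong₂ ℤ._+_ (cong (c (suc i) ℤ.*_) (det-cong (suc n) λ r s → cong (λ row → row s) (sym (update-punchIn R i r))))
         (cong₂ ℤ._*_ (cong c (sym (punchIn-suc-self i))) (det-cong (suc n) λ r s → cong (λ row → row s) (sym (update-self M i r)))) ⟩
  t (suc i) ℤ.+ t (punchIn (suc i) i)
    ≡⟨ cong (λ z → t (suc i) ℤ.+ z) (sym (ℤₚ.+-identityʳ _)) ⟩
  t (suc i) ℤ.+ (t (punchIn (suc i) i) ℤ.+ 0ℤ)
    ≡⟨ cong (λ z → t (suc i) ℤ.+ (t (punchIn (suc i) i) ℤ.+ z)) (sym (sum-zero n others)) ⟩
  -- The indices other than i and i+1 are exactly `punchIn (suc i) (punchIn i r)`. Their terms
  -- vanish by `others`, so adding them completes the full sum.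
  t (suc i) ℤ.+ (t (punchIn (suc i) i) ℤ.+ sum (λ r → t (punchIn (suc i) (punchIn i r))))
    ≡⟨ cong (λ z → t (suc i) ℤ.+ z) (sym (sum-remove {i = i} (t ∘ punchIn (suc i)))) ⟩
  t (suc i) ℤ.+ sum (t ∘ punchIn (suc i))
    ≡⟨ sym (sum-remove {i = suc i} t) ⟩
  sum t
    ≡⟨ sym (det-linear (suc n) M i c R) ⟩
  det (suc n) (M [ i ]≔ (λ s → sum (λ j → c j ℤ.* R j s)))
    ≡⟨ det-cong (suc n) zeroRow ⟩
  det (suc n) (M [ i ]≔ const 0ℤ)
    ≡⟨ det-zeroRow (suc n) M i ⟩
  0ℤ ∎
  where
  M = R ∘ punchIn (suc i)
  t = λ j → c j ℤ.* det (suc n) (M [ i ]≔ R j)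
  others : ∀ r → t (punchIn (suc i) (punchIn i r)) ≡ 0ℤ
  -- Here `R p` already stands in row `punchIn i r` of `M`, and it is now also in row `i`.
  others r = trans
    (cong (c p ℤ.*_) (det-alternating (suc n) (M [ i ]≔ R p) i (punchIn i r) (≢-sym (punchInᵢ≢i i r)) λ s →
      cong (λ row → row s) (trans (updateAt-updates i {const (R p)} M)
        (sym (updateAt-minimal (punchIn i r) i M (punchInᵢ≢i i r))))))
    (ℤₚ.*-zeroʳ (c p))
    where p = punchIn (suc i) (punchIn i r)
  zeroRow : ∀ r s → (M [ i ]≔ (λ s → sum (λ j → c j ℤ.* R j s))) r s ≡ (M [ i ]≔ const 0ℤ) r s
  zeroRow r s = trans (update-∘ (λ row → row s) M i _ r)
    (trans (cong (λ z → ((λ r → M r s) [ i ]≔ z) r) (relation s)) (sym (update-∘ (λ row → row s) M i _ r)))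

-- Removing a last column (0, ..., 0, 1)

punchIn-inject₁-fromℕ : ∀ {n} (j : Fin (suc n)) → punchIn (inject₁ j) (fromℕ n) ≡ fromℕ (suc n)
punchIn-inject₁-fromℕ {n} zero = refl
punchIn-inject₁-fromℕ {suc n} (suc j) = cong suc (punchIn-inject₁-fromℕ j)

punchIn-inject₁ : ∀ {n} (j : Fin (suc n)) s → punchIn (inject₁ j) (inject₁ s) ≡ inject₁ (punchIn j s)
punchIn-inject₁ zero s = refl
punchIn-inject₁ (suc j) zero = refl
punchIn-inject₁ (suc j) (suc s) = cong suc (punchIn-inject₁ j s)

-- Expansion along row 0: the term of the last column vanishes, and every other minor again has last
-- column (0, ..., 0, 1), so induction applies.
det-lastColumn : ∀ n (M : Matrix (suc n)) → (∀ r → M (inject₁ r) (fromℕ n) ≡ 0ℤ) → M (fromℕ n) (fromℕ n) ≡ + 1 →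
  det (suc n) M ≡ det n (λ r s → M (inject₁ r) (inject₁ s))
det-lastColumn zero M zeros one = cong (λ z → + 1 ℤ.* z ℤ.* + 1 ℤ.+ 0ℤ) one
det-lastColumn (suc n) M zeros one = begin
  det (suc (suc n)) M
    ≡⟨ det-laplace (suc n) M ⟩
  alt (suc (suc n)) (λ j → M zero j ℤ.* det (suc n) (minor M j))
    ≡⟨ alt-init (suc n) (λ j → M zero j ℤ.* det (suc n) (minor M j)) (cong (ℤ._* det (suc n) (minor M (fromℕ (suc n)))) (zeros zero)) ⟩
  alt (suc n) (λ j → M zero (inject₁ j) ℤ.* det (suc n) (minor M (inject₁ j)))
    ≡⟨ alt-cong (suc n) (λ j → cong (M zero (inject₁ j) ℤ.*_) (trans
         (det-lastColumn n (minor M (inject₁ j))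
           (λ r → trans (cong (M (suc (inject₁ r))) (punchIn-inject₁-fromℕ j)) (zeros (suc r)))
           (trans (cong (M (suc (fromℕ n))) (punchIn-inject₁-fromℕ j)) one))
         (det-cong n (λ r s → cong (M (suc (inject₁ r))) (punchIn-inject₁ j s))))) ⟩
  alt (suc n) (λ j → M zero (inject₁ j) ℤ.* det n (λ r s → M (suc (inject₁ r)) (inject₁ (punchIn j s))))
    ≡⟨ sym (det-laplace n (λ r s → M (inject₁ r) (inject₁ s))) ⟩
  det (suc n) (λ r s → M (inject₁ r) (inject₁ s)) ∎

-- Binomial sums

binom≡C : ∀ a b → binom a b ≡ a C b
binom≡C a b with a ℕ.<ᵇ b in eq
... | true = sym (k>n⇒nCk≡0 (ℕₚ.<ᵇ⇒< a b (subst T (sym eq) tt)))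
... | false = refl

C-absorb : ∀ n k → suc n * (n C k) ≡ suc k * (suc n C suc k)
C-absorb n zero = trans (ℕₚ.*-identityʳ (suc n)) (trans (sym (nC1≡n (suc n))) (sym (ℕₚ.*-identityˡ (suc n C 1))))
C-absorb zero (suc k) = sym (ℕₚ.*-zeroʳ (suc (suc k)))
C-absorb (suc n) (suc k) = begin
  suc (suc n) * x                              ≡⟨ cong (λ t → x + suc n * t) (sym (nCk+nC[k+1]≡[n+1]C[k+1] n k)) ⟩
  x + suc n * (n C k + n C suc k)              ≡⟨ cong (λ t → x + t) (ℕₚ.*-distribˡ-+ (suc n) (n C k) (n C suc k)) ⟩
  x + (suc n * (n C k) + suc n * (n C suc k))  ≡⟨ cong₂ (λ s t → x + (s + t)) (C-absorb n k) (C-absorb n (suc k)) ⟩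
  x + (suc k * x + suc (suc k) * y)            ≡⟨ regroup k x y ⟩
  suc (suc k) * (x + y)                        ≡⟨ cong (suc (suc k) *_) (nCk+nC[k+1]≡[n+1]C[k+1] (suc n) (suc k)) ⟩
  suc (suc k) * (suc (suc n) C suc (suc k))    ∎
  where
  x = suc n C suc k
  y = suc n C suc (suc k)
  regroup : ∀ k x y → x + (suc k * x + suc (suc k) * y) ≡ suc (suc k) * (x + y)
  regroup = ℕ-Solver.solve-∀

-- weight m i is the coefficient of x^i in (1 + x)(2 + x)^m.
weight : ℕ → ℕ → ℕ
weight zero zero = 1
weight zero (suc zero) = 1
weight zero (suc (suc i)) = 0
weight (suc m) zero = 2 * weight m zero
weight (suc m) (suc i) = 2 * weight m (suc i) + weight m i

weight-0 : ∀ m → weight m 0 ≡ 2 ^ m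
weight-0 zero = refl
weight-0 (suc m) = cong (2 *_) (weight-0 m)

weight-vanish : ∀ m i → m < i → weight m (suc i) ≡ 0
weight-vanish zero (suc i) m<i = refl
weight-vanish (suc m) (suc i) (s≤s m<i) =
  cong₂ (λ x y → 2 * x + y) (weight-vanish m (suc i) (ℕₚ.m<n⇒m<1+n m<i)) (weight-vanish m i m<i)

weight-top : ∀ m → weight m (suc m) ≡ 1
weight-top zero = refl
weight-top (suc m) = cong₂ (λ x y → 2 * x + y) (weight-vanish m (suc m) (ℕₚ.n<1+n m)) (weight-top m)

-- Allows the cancellation of `weight m i` in `D-ratio`.
weight-pos : ∀ m i → i ≤ suc m → 0 < weight m i
weight-pos zero zero i≤ = s≤s z≤n
weight-pos zero (suc zero) i≤ = s≤s z≤n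
weight-pos zero (suc (suc i)) (s≤s ())
weight-pos (suc m) zero i≤ = ℕₚ.<-≤-trans (weight-pos m zero z≤n) (ℕₚ.m≤m+n _ _)
weight-pos (suc m) (suc i) (s≤s i≤) = ℕₚ.<-≤-trans (weight-pos m i i≤) (ℕₚ.m≤n+m (weight m i) (2 * weight m (suc i)))

-- The coefficient of x^(i+1) in (1 + x)(2 + x)^m is 2^(m-i-1) C(m,i+1) + 2^(m-i) C(m,i). The factor
-- 2^(i+1) avoids negative exponents, and Pascal's rule rewrites C(m,i+1) + 2 C(m,i) as the bracket.
weight-suc-closed : ∀ m i → 2 ^ suc i * weight m (suc i) ≡ 2 ^ m * (suc m C suc i + m C i)
weight-suc-closed zero zero = refl
weight-suc-closed zero (suc i) = ℕₚ.*-zeroʳ (2 ^ suc (suc i))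
weight-suc-closed (suc m) zero = begin
  2 * (2 * weight m 1 + weight m 0)               ≡⟨ cong₂ (λ x y → 2 * (x + y)) (weight-suc-closed m zero) (weight-0 m) ⟩
  2 * (2 ^ m * (suc m C 1 + 1) + (2 ^ m))           ≡⟨ regroup (2 ^ m) (suc m C 1) ⟩
  2 * 2 ^ m * ((1 + suc m C 1) + 1)               ≡⟨ cong (λ t → 2 * 2 ^ m * (t + 1)) (nCk+nC[k+1]≡[n+1]C[k+1] (suc m) 0) ⟩
  2 * 2 ^ m * (suc (suc m) C 1 + 1)               ∎
  where
  regroup : ∀ p x → 2 * (p * (x + 1) + p) ≡ 2 * p * ((1 + x) + 1)
  regroup = ℕ-Solver.solve-∀
weight-suc-closed (suc m) (suc i) = begin
  2 ^ suc (suc i) * (2 * weight m (suc (suc i)) + weight m (suc i))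
    ≡⟨ split (2 ^ suc i) (weight m (suc (suc i))) (weight m (suc i)) ⟩
  2 * (2 ^ suc (suc i) * weight m (suc (suc i))) + 2 * (2 ^ suc i * weight m (suc i))
    ≡⟨ cong₂ (λ x y → 2 * x + 2 * y) (weight-suc-closed m (suc i)) (weight-suc-closed m i) ⟩
  2 * (2 ^ m * (suc m C suc (suc i) + m C suc i)) + 2 * (2 ^ m * (suc m C suc i + m C i))
    ≡⟨ regroup (2 ^ m) (suc m C suc (suc i)) (m C suc i) (suc m C suc i) (m C i) ⟩
  2 * 2 ^ m * ((suc m C suc i + suc m C suc (suc i)) + (m C i + m C suc i))
    ≡⟨ cong₂ (λ x y → 2 * 2 ^ m * (x + y)) (nCk+nC[k+1]≡[n+1]C[k+1] (suc m) (suc i)) (nCk+nC[k+1]≡[n+1]C[k+1] m i) ⟩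
  2 ^ suc m * (suc (suc m) C suc (suc i) + suc m C suc i) ∎
  where
  split : ∀ p x y → 2 * p * (2 * x + y) ≡ 2 * (2 * p * x) + 2 * (p * y)
  split = ℕ-Solver.solve-∀
  regroup : ∀ p a b c d → 2 * (p * (a + b)) + 2 * (p * (c + d)) ≡ 2 * p * ((c + a) + (d + b))
  regroup = ℕ-Solver.solve-∀

-- Source of the factor (d+i)/d, with d = m+1: absorption turns d C(m,i) into (i+1) C(d,i+1), which
-- joins d C(d,i+1) to give (d+i+1) C(d,i+1).
weight-closed : ∀ m i → suc m * 2 ^ i * weight m i ≡ 2 ^ m * ((suc m C i) * (suc m + i))
weight-closed m zero = begin
  suc m * 1 * weight m 0      ≡⟨ cong (suc m * 1 *_) (weight-0 m) ⟩
  suc m * 1 * 2 ^ m           ≡⟨ regroup m (2 ^ m) ⟩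
  2 ^ m * (1 * (suc m + 0))   ∎
  where
  regroup : ∀ m p → suc m * 1 * p ≡ p * (1 * (suc m + 0))
  regroup = ℕ-Solver.solve-∀
weight-closed m (suc i) = begin
  suc m * 2 ^ suc i * weight m (suc i)                ≡⟨ ℕₚ.*-assoc (suc m) (2 ^ suc i) (weight m (suc i)) ⟩
  suc m * (2 ^ suc i * weight m (suc i))              ≡⟨ cong (suc m *_) (weight-suc-closed m i) ⟩
  suc m * (2 ^ m * (suc m C suc i + m C i))           ≡⟨ split m (2 ^ m) (suc m C suc i) (m C i) ⟩
  2 ^ m * (suc m * (suc m C suc i) + suc m * (m C i)) ≡⟨ cong (λ t → 2 ^ m * (suc m * (suc m C suc i) + t)) (C-absorb m i) ⟩
  2 ^ m * (suc m * (suc m C suc i) + suc i * (suc m C suc i)) ≡⟨ join m i (2 ^ m) (suc m C suc i) ⟩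
  2 ^ m * ((suc m C suc i) * (suc m + suc i))         ∎
  where
  split : ∀ m p x y → suc m * (p * (x + y)) ≡ p * (suc m * x + suc m * y)
  split = ℕ-Solver.solve-∀
  join : ∀ m i p x → p * (suc m * x + suc i * x) ≡ p * (x * (suc m + suc i))
  join = ℕ-Solver.solve-∀

-- The coefficient of x^i in (1 - x)(2 - x)^m, obtained from `weight` by replacing x with -x.
coeff : ℕ → ℕ → ℤ
coeff m i = sgn i ℤ.* + weight m i

coeff-zero : ∀ m → coeff (suc m) 0 ≡ + 2 ℤ.* coeff m 0
coeff-zero m = trans (cong (+ 1 ℤ.*_) (ℤₚ.pos-* 2 (weight m 0))) (lemma (+ weight m 0))
  where
  lemma : ∀ x → + 1 ℤ.* (+ 2 ℤ.* x) ≡ + 2 ℤ.* (+ 1 ℤ.* x)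
  lemma = solve-∀

coeff-suc : ∀ m i → coeff (suc m) (suc i) ≡ + 2 ℤ.* coeff m (suc i) ℤ.- coeff m i
coeff-suc m i = begin
  sgn (suc i) ℤ.* + (2 * weight m (suc i) + weight m i)
    ≡⟨ cong₂ ℤ._*_ (sgn-suc i) (trans (ℤₚ.pos-+ (2 * weight m (suc i)) (weight m i)) (cong (λ t → t ℤ.+ + weight m i) (ℤₚ.pos-* 2 (weight m (suc i))))) ⟩
  (- sgn i) ℤ.* (+ 2 ℤ.* + weight m (suc i) ℤ.+ + weight m i)
    ≡⟨ lemma (sgn i) (+ weight m (suc i)) (+ weight m i) ⟩
  + 2 ℤ.* ((- sgn i) ℤ.* + weight m (suc i)) ℤ.- sgn i ℤ.* + weight m i
    ≡⟨ cong (λ t → + 2 ℤ.* (t ℤ.* + weight m (suc i)) ℤ.- sgn i ℤ.* + weight m i) (sym (sgn-suc i)) ⟩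
  + 2 ℤ.* coeff m (suc i) ℤ.- coeff m i ∎
  where
  lemma : ∀ s x y → (- s) ℤ.* (+ 2 ℤ.* x ℤ.+ y) ≡ + 2 ℤ.* ((- s) ℤ.* x) ℤ.- s ℤ.* y
  lemma = solve-∀

-- The linear relation between binomial rows

rangeSum : ℕ → (ℕ → ℤ) → ℤ
rangeSum k h = sum {k} (h ∘ toℕ)

rangeSum-init : ∀ k h → h k ≡ 0ℤ → rangeSum (suc k) h ≡ rangeSum k h
rangeSum-init zero h eq = trans (ℤₚ.+-identityʳ (h 0)) eq
rangeSum-init (suc k) h eq = cong (λ t → h 0 ℤ.+ t) (rangeSum-init k (h ∘ suc) eq)

rangeSum-2p-q : ∀ k p q → rangeSum k (λ i → + 2 ℤ.* p i ℤ.- q i) ≡ + 2 ℤ.* rangeSum k p ℤ.- rangeSum k q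
rangeSum-2p-q zero p q = refl
rangeSum-2p-q (suc k) p q = trans
  (cong (λ t → + 2 ℤ.* p 0 ℤ.- q 0 ℤ.+ t) (rangeSum-2p-q k (p ∘ suc) (q ∘ suc)))
  (lemma (p 0) (q 0) (rangeSum k (p ∘ suc)) (rangeSum k (q ∘ suc)))
  where
  lemma : ∀ a b x y → + 2 ℤ.* a ℤ.- b ℤ.+ (+ 2 ℤ.* x ℤ.- y) ≡ + 2 ℤ.* (a ℤ.+ x) ℤ.- (b ℤ.+ y)
  lemma = solve-∀

-- The linear functional x^i ↦ `f i`, evaluated at (1 - x)(2 - x)^m, a polynomial of degree m+1.
pairing : ℕ → (ℕ → ℤ) → ℤ
pairing m f = rangeSum (suc (suc m)) (λ i → coeff m i ℤ.* f i)

pairing-cong : ∀ m {f h : ℕ → ℤ} → f ≗ h → pairing m f ≡ pairing m h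
pairing-cong m eq = sum-cong-≗ {suc (suc m)} (λ j → cong (coeff m (toℕ j) ℤ.*_) (eq (toℕ j)))

pairing-0 : ∀ f → pairing 0 f ≡ f 0 ℤ.- f 1
pairing-0 f = lemma (f 0) (f 1)
  where
  lemma : ∀ x y → + 1 ℤ.* x ℤ.+ (- + 1 ℤ.* y ℤ.+ 0ℤ) ≡ x ℤ.- y
  lemma = solve-∀

-- One more factor 2 - x; multiplication by x shifts `f`.
pairing-suc : ∀ m f → pairing (suc m) f ≡ + 2 ℤ.* pairing m f ℤ.- pairing m (f ∘ suc)
pairing-suc m f = begin
  coeff (suc m) 0 ℤ.* f 0 ℤ.+ rangeSum (suc (suc m)) (λ i → coeff (suc m) (suc i) ℤ.* f (suc i))
    ≡⟨ cong₂ ℤ._+_ (cong (ℤ._* f 0) (coeff-zero m))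
         (sum-cong-≗ {suc (suc m)} λ j → trans (cong (ℤ._* f (suc (toℕ j))) (coeff-suc m (toℕ j)))
           (distribute (coeff m (suc (toℕ j))) (coeff m (toℕ j)) (f (suc (toℕ j))))) ⟩
  + 2 ℤ.* coeff m 0 ℤ.* f 0 ℤ.+ rangeSum (suc (suc m)) (λ i → + 2 ℤ.* p (suc i) ℤ.- q i)
    ≡⟨ cong (λ t → + 2 ℤ.* coeff m 0 ℤ.* f 0 ℤ.+ t) (rangeSum-2p-q (suc (suc m)) (p ∘ suc) q) ⟩
  + 2 ℤ.* coeff m 0 ℤ.* f 0 ℤ.+ (+ 2 ℤ.* rangeSum (suc (suc m)) (p ∘ suc) ℤ.- pairing m (f ∘ suc))
    ≡⟨ regroup (coeff m 0) (f 0) (rangeSum (suc (suc m)) (p ∘ suc)) (pairing m (f ∘ suc)) ⟩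
  + 2 ℤ.* rangeSum (suc (suc (suc m))) p ℤ.- pairing m (f ∘ suc)
    ≡⟨ cong (λ t → + 2 ℤ.* t ℤ.- pairing m (f ∘ suc)) (rangeSum-init (suc (suc m)) p p-top) ⟩
  + 2 ℤ.* pairing m f ℤ.- pairing m (f ∘ suc) ∎
  where
  p = λ i → coeff m i ℤ.* f i
  q = λ i → coeff m i ℤ.* f (suc i)
  p-top : p (suc (suc m)) ≡ 0ℤ
  -- The index m+2 exceeds the degree m+1; `sgn (suc (suc m))` computes to `sgn m`.
  p-top = trans (cong (λ t → sgn m ℤ.* + t ℤ.* f (suc (suc m))) (weight-vanish m (suc m) (ℕₚ.n<1+n m)))
    (cong (ℤ._* f (suc (suc m))) (ℤₚ.*-zeroʳ (sgn m)))
  distribute : ∀ a b x → (+ 2 ℤ.* a ℤ.- b) ℤ.* x ≡ + 2 ℤ.* (a ℤ.* x) ℤ.- b ℤ.* x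
  distribute = solve-∀
  regroup : ∀ a x y z → + 2 ℤ.* a ℤ.* x ℤ.+ (+ 2 ℤ.* y ℤ.- z) ≡ + 2 ℤ.* (a ℤ.* x ℤ.+ y) ℤ.- z
  regroup = solve-∀

-- This is the value of (1 - x)(2 - x)^m at x = 1.
pairing-one : ∀ m → pairing m (λ _ → + 1) ≡ 0ℤ
pairing-one zero = refl
pairing-one (suc m) = trans (pairing-suc m (λ _ → + 1)) (cong (λ t → + 2 ℤ.* t ℤ.- t) (pairing-one m))

-- mixed m a b is the coefficient of y^b in (1 - y)^m (1 + y)^a.
mixed : ℕ → ℕ → ℕ → ℤ
mixed zero a b = + (a C b)
mixed (suc m) a zero = mixed m a zero
mixed (suc m) a (suc b) = mixed m a (suc b) ℤ.- mixed m a b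

mixed-suc-zero : ∀ m a → mixed m (suc a) 0 ≡ mixed m a 0
mixed-suc-zero zero a = refl
mixed-suc-zero (suc m) a = mixed-suc-zero m a

-- Multiplication by 1 + y: Pascal's rule for m = 0, carried along since it commutes with
-- multiplication by 1 - y.
mixed-suc-suc : ∀ m a b → mixed m (suc a) (suc b) ≡ mixed m a (suc b) ℤ.+ mixed m a b
mixed-suc-suc zero a b = cong +_ (trans (sym (nCk+nC[k+1]≡[n+1]C[k+1] a b)) (ℕₚ.+-comm (a C b) (a C suc b)))
mixed-suc-suc (suc m) a zero = trans
  (cong₂ ℤ._-_ (mixed-suc-suc m a 0) (mixed-suc-zero m a))
  (lemma (mixed m a 1) (mixed m a 0))
  where
  lemma : ∀ x y → x ℤ.+ y ℤ.- y ≡ x ℤ.- y ℤ.+ y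
  lemma = solve-∀
mixed-suc-suc (suc m) a (suc b) = trans
  (cong₂ ℤ._-_ (mixed-suc-suc m a (suc b)) (mixed-suc-suc m a b))
  (lemma (mixed m a (suc (suc b))) (mixed m a (suc b)) (mixed m a b))
  where
  lemma : ∀ x y z → x ℤ.+ y ℤ.- (y ℤ.+ z) ≡ x ℤ.- y ℤ.+ (y ℤ.- z)
  lemma = solve-∀

-- The polynomial (1 - y)^m (1 + y)^m = (1 - y²)^m is even. In the induction, the extra factor 1 -
-- y² subtracts the coefficient two places below.
mixed-odd : ∀ m s → mixed m m (suc (2 * s)) ≡ 0ℤ
mixed-odd zero s = refl
mixed-odd (suc m) zero = begin
  mixed m (suc m) 1 ℤ.- mixed m (suc m) 0           ≡⟨ cong₂ ℤ._-_ (mixed-suc-suc m m 0) (mixed-suc-zero m m) ⟩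
  mixed m m 1 ℤ.+ mixed m m 0 ℤ.- mixed m m 0       ≡⟨ lemma (mixed m m 1) (mixed m m 0) ⟩
  mixed m m 1                                       ≡⟨ mixed-odd m 0 ⟩
  0ℤ                                                ∎
  where
  lemma : ∀ x y → x ℤ.+ y ℤ.- y ≡ x
  lemma = solve-∀
mixed-odd (suc m) (suc s) = begin
  mixed (suc m) (suc m) (suc (2 * suc s))           ≡⟨ cong (mixed (suc m) (suc m) ∘ suc) (ℕₚ.*-suc 2 s) ⟩
  mixed m (suc m) (3 + k) ℤ.- mixed m (suc m) (2 + k)
    ≡⟨ cong₂ ℤ._-_ (mixed-suc-suc m m (2 + k)) (mixed-suc-suc m m (1 + k)) ⟩
  mixed m m (3 + k) ℤ.+ mixed m m (2 + k) ℤ.- (mixed m m (2 + k) ℤ.+ mixed m m (1 + k))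
    ≡⟨ lemma (mixed m m (3 + k)) (mixed m m (2 + k)) (mixed m m (1 + k)) ⟩
  mixed m m (3 + k) ℤ.- mixed m m (1 + k)
    ≡⟨ cong₂ ℤ._-_ (trans (cong (mixed m m ∘ suc) (sym (ℕₚ.*-suc 2 s))) (mixed-odd m (suc s))) (mixed-odd m s) ⟩
  0ℤ                                                ∎
  where
  k = 2 * s
  lemma : ∀ x y z → x ℤ.+ y ℤ.- (y ℤ.+ z) ≡ x ℤ.- z
  lemma = solve-∀

-- At x = 1 + y, x^a (1 - x)(2 - x)^m becomes -y (1 - y)^m (1 + y)^a. The exponent `a` is free
-- because the induction on `m` raises it.
pairing-C : ∀ m a b → pairing m (λ i → + ((a + i) C suc b)) ≡ - mixed m a b
pairing-C zero a b = begin
  pairing 0 (λ i → + ((a + i) C suc b))                  ≡⟨ pairing-0 (λ i → + ((a + i) C suc b)) ⟩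
  + ((a + 0) C suc b) ℤ.- + ((a + 1) C suc b)            ≡⟨ cong₂ (λ x y → + (x C suc b) ℤ.- + (y C suc b)) (ℕₚ.+-identityʳ a) (ℕₚ.+-comm a 1) ⟩
  + (a C suc b) ℤ.- + (suc a C suc b)                    ≡⟨ cong (λ t → + (a C suc b) ℤ.- t) (mixed-suc-suc 0 a b) ⟩
  + (a C suc b) ℤ.- (+ (a C suc b) ℤ.+ + (a C b))        ≡⟨ lemma (+ (a C suc b)) (+ (a C b)) ⟩
  - + (a C b)                                            ∎
  where
  lemma : ∀ x y → x ℤ.- (x ℤ.+ y) ≡ - y
  lemma = solve-∀
pairing-C (suc m) a b = begin
  pairing (suc m) (λ i → + ((a + i) C suc b))
    ≡⟨ pairing-suc m (λ i → + ((a + i) C suc b)) ⟩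
  + 2 ℤ.* pairing m (λ i → + ((a + i) C suc b)) ℤ.- pairing m (λ i → + ((a + suc i) C suc b))
    ≡⟨ cong₂ (λ x y → + 2 ℤ.* x ℤ.- y) (pairing-C m a b)
         (trans (pairing-cong m (λ i → cong (λ t → + (t C suc b)) (ℕₚ.+-suc a i))) (pairing-C m (suc a) b)) ⟩
  + 2 ℤ.* - mixed m a b ℤ.- - mixed m (suc a) b
    ≡⟨ step b ⟩
  - mixed (suc m) a b ∎
  where
  -- The identity 2 - (1 + y) = 1 - y, read off coefficient by coefficient.
  step : ∀ b → + 2 ℤ.* - mixed m a b ℤ.- - mixed m (suc a) b ≡ - mixed (suc m) a b
  step zero = trans (cong (λ t → + 2 ℤ.* - mixed m a 0 ℤ.- - t) (mixed-suc-zero m a)) (lemma (mixed m a 0))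
    where
    lemma : ∀ x → + 2 ℤ.* - x ℤ.- - x ≡ - x
    lemma = solve-∀
  step (suc b) = trans (cong (λ t → + 2 ℤ.* - mixed m a (suc b) ℤ.- - t) (mixed-suc-suc m a b)) (lemma (mixed m a (suc b)) (mixed m a b))
    where
    lemma : ∀ x y → + 2 ℤ.* - x ℤ.- - (x ℤ.+ y) ≡ - (x ℤ.- y)
    lemma = solve-∀

pairing-even : ∀ m s → pairing m (λ i → + ((m + i) C (2 * s))) ≡ 0ℤ
pairing-even m zero = pairing-one m
pairing-even m (suc s) = begin
  pairing m (λ i → + ((m + i) C (2 * suc s)))       ≡⟨ pairing-cong m (λ i → cong (λ t → + ((m + i) C t)) (ℕₚ.*-suc 2 s)) ⟩
  pairing m (λ i → + ((m + i) C suc (suc (2 * s)))) ≡⟨ pairing-C m m (suc (2 * s)) ⟩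
  - mixed m m (suc (2 * s))                         ≡⟨ cong -_ (mixed-odd m s) ⟩
  0ℤ                                                ∎

-- The minors D_{d,i}, with d = suc m

rows : ∀ m → Fin (suc (suc m)) → Fin (suc m) → ℤ
rows m j s = + binom (m + toℕ j) (2 * toℕ s)

rows-relation : ∀ m s → sum (λ j → coeff m (toℕ j) ℤ.* rows m j s) ≡ 0ℤ
rows-relation m s = trans (pairing-cong m (λ i → cong +_ (binom≡C (m + i) (2 * toℕ s)))) (pairing-even m (toℕ s))

-- The conditional in `topRow` is `punchIn` in disguise; `F` is arbitrary so that the induction can
-- pass to `F ∘ suc`.
if-punchIn : ∀ {n} {A : Set} (F : ℕ → A) (j : Fin (suc n)) (r : Fin n) →
  (if toℕ r ℕ.<ᵇ toℕ j then F (toℕ r) else F (suc (toℕ r))) ≡ F (toℕ (punchIn j r))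
if-punchIn F zero r = refl
if-punchIn F (suc j) zero = refl
if-punchIn F (suc j) (suc r) = if-punchIn (F ∘ suc) j r

topRow-punchIn : ∀ m j r → topRow (suc m) (toℕ j) r ≡ m + toℕ (punchIn j r)
topRow-punchIn m j r = trans
  (cong (λ t → if toℕ r ℕ.<ᵇ toℕ j then m + toℕ r else t) (sym (ℕₚ.+-suc m (toℕ r))))
  (if-punchIn (λ t → m + t) j r)

D-minor : ∀ m i (j : Fin (suc (suc m))) → toℕ j ≡ i → D (suc m) i ≡ det (suc m) (rows m ∘ punchIn j)
D-minor m .(toℕ j) j refl =
  det-cong (suc m) (λ r s → cong (λ t → + binom t (2 * toℕ s)) (topRow-punchIn m j r))

sgn-involutive : ∀ i → sgn i ℤ.* sgn i ≡ + 1
sgn-involutive zero = refl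
sgn-involutive (suc zero) = refl
sgn-involutive (suc (suc i)) = sgn-involutive i

-- The coefficients alternate in sign, so the vanishing sum from `adjacentMinors` becomes an
-- equality between positive multiples.
D-adjacent : ∀ m i → i ≤ m → + weight m i ℤ.* D (suc m) (suc i) ≡ + weight m (suc i) ℤ.* D (suc m) i
D-adjacent m i i≤m = begin
  w ℤ.* D′ ≡⟨ sym (ℤₚ.*-identityˡ (w ℤ.* D′)) ⟩
  + 1 ℤ.* (w ℤ.* D′) ≡⟨ cong (ℤ._* (w ℤ.* D′)) (sym (sgn-involutive i)) ⟩
  -- Multiplying the relation by σ removes its signs, as σ² = 1.
  σ ℤ.* σ ℤ.* (w ℤ.* D′) ≡⟨ isolate σ w w′ D₀ D′ ⟩
  σ ℤ.* ((- σ) ℤ.* w′ ℤ.* D₀ ℤ.+ σ ℤ.* w ℤ.* D′) ℤ.+ σ ℤ.* σ ℤ.* (w′ ℤ.* D₀)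
    ≡⟨ cong₂ (λ x y → σ ℤ.* x ℤ.+ y ℤ.* (w′ ℤ.* D₀)) relation (sgn-involutive i) ⟩
  σ ℤ.* 0ℤ ℤ.+ + 1 ℤ.* (w′ ℤ.* D₀) ≡⟨ tidy σ (w′ ℤ.* D₀) ⟩
  w′ ℤ.* D₀ ∎
  where
  σ = sgn i
  w = + weight m i
  w′ = + weight m (suc i)
  D₀ = D (suc m) i
  D′ = D (suc m) (suc i)
  j = fromℕ< (s≤s i≤m)
  j≡i : toℕ j ≡ i
  j≡i = toℕ-fromℕ< (s≤s i≤m)
  inject₁j≡i : toℕ (inject₁ j) ≡ i
  inject₁j≡i = trans (toℕ-inject₁ j) j≡i
  relation : (- σ) ℤ.* w′ ℤ.* D₀ ℤ.+ σ ℤ.* w ℤ.* D′ ≡ 0ℤ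
  relation = begin
    (- σ) ℤ.* w′ ℤ.* D₀ ℤ.+ σ ℤ.* w ℤ.* D′
      ≡⟨ cong₂ ℤ._+_
           (cong₂ ℤ._*_ (trans (cong (ℤ._* w′) (sym (sgn-suc i))) (cong (coeff m ∘ suc) (sym j≡i))) (D-minor m i (inject₁ j) inject₁j≡i))
           (cong₂ ℤ._*_ (cong (coeff m) (sym inject₁j≡i)) (D-minor m (suc i) (suc j) (cong suc j≡i))) ⟩
    coeff m (suc (toℕ j)) ℤ.* det (suc m) (rows m ∘ punchIn (inject₁ j)) ℤ.+
    coeff m (toℕ (inject₁ j)) ℤ.* det (suc m) (rows m ∘ punchIn (suc j))
      ≡⟨ adjacentMinors m (rows m) (coeff m ∘ toℕ) (rows-relation m) j ⟩
    0ℤ ∎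
  isolate : ∀ σ w w′ d d′ → σ ℤ.* σ ℤ.* (w ℤ.* d′) ≡
    σ ℤ.* ((- σ) ℤ.* w′ ℤ.* d ℤ.+ σ ℤ.* w ℤ.* d′) ℤ.+ σ ℤ.* σ ℤ.* (w′ ℤ.* d)
  isolate = solve-∀
  tidy : ∀ σ x → σ ℤ.* 0ℤ ℤ.+ + 1 ℤ.* x ≡ x
  tidy = solve-∀

-- `D-adjacent` telescoped from 0 to `i`, cancelling the positive intermediate weight at each step.
D-ratio : ∀ m i → i ≤ suc m → + weight m 0 ℤ.* D (suc m) i ≡ + weight m i ℤ.* D (suc m) 0
D-ratio m zero i≤ = refl
D-ratio m (suc i) (s≤s i≤m) = ℤₚ.*-cancelˡ-≡ w _ _ {{ℕ.>-nonZero (weight-pos m i i≤1+m)}} (begin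
  w ℤ.* (w₀ ℤ.* D (suc m) (suc i))  ≡⟨ exchange w w₀ (D (suc m) (suc i)) ⟩
  w₀ ℤ.* (w ℤ.* D (suc m) (suc i))  ≡⟨ cong (w₀ ℤ.*_) (D-adjacent m i i≤m) ⟩
  w₀ ℤ.* (w′ ℤ.* D (suc m) i)       ≡⟨ exchange w₀ w′ (D (suc m) i) ⟩
  w′ ℤ.* (w₀ ℤ.* D (suc m) i)       ≡⟨ cong (w′ ℤ.*_) (D-ratio m i i≤1+m) ⟩
  w′ ℤ.* (w ℤ.* D (suc m) 0)        ≡⟨ exchange w′ w (D (suc m) 0) ⟩
  w ℤ.* (w′ ℤ.* D (suc m) 0)        ∎)
  where
  i≤1+m = ℕₚ.m≤n⇒m≤1+n i≤m
  w₀ = + weight m 0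
  w = + weight m i
  w′ = + weight m (suc i)
  exchange : ∀ x y z → x ℤ.* (y ℤ.* z) ≡ y ℤ.* (x ℤ.* z)
  exchange = solve-∀

topRow-below : ∀ d i r → toℕ r < i → topRow d i r ≡ (d ∸ 1) + toℕ r
topRow-below d i r r<i with toℕ r ℕ.<ᵇ i | ℕₚ.<⇒<ᵇ r<i
... | true | _ = refl

-- With d = m+2, the top row is d-1, ..., 2d-2 and the last bottom entry is 2d-2, whence the last
-- column (0, ..., 0, 1). The corner left over has top row d-1, ..., 2d-3, that of D_{d-1,0}.
D-top : ∀ m → D (suc (suc m)) (suc (suc m)) ≡ D (suc m) 0
D-top m = trans (det-lastColumn (suc m) M zeros one) (det-cong (suc m) corner)
  where
  M : Matrix (suc (suc m))
  M r s = + binom (topRow (suc (suc m)) (suc (suc m)) r) (2 * toℕ s)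
  entry : ∀ r s → M r s ≡ + ((suc m + toℕ r) C (2 * toℕ s))
  entry r s = trans (cong (λ t → + binom t (2 * toℕ s)) (topRow-below (suc (suc m)) (suc (suc m)) r (toℕ<n r)))
    (cong +_ (binom≡C (suc m + toℕ r) (2 * toℕ s)))
  last : ∀ r k → toℕ r ≡ k → M r (fromℕ (suc m)) ≡ + ((suc m + k) C (suc m + suc m))
  last r k eq = trans (entry r (fromℕ (suc m))) (cong₂ (λ x y → + ((suc m + x) C y)) eq
    (trans (cong (2 *_) (toℕ-fromℕ (suc m))) (cong (λ t → suc m + t) (ℕₚ.+-identityʳ (suc m)))))
  zeros : ∀ r → M (inject₁ r) (fromℕ (suc m)) ≡ 0ℤ
  zeros r = trans (last (inject₁ r) (toℕ r) (toℕ-inject₁ r)) (cong +_ (k>n⇒nCk≡0 (ℕₚ.+-monoʳ-< (suc m) (toℕ<n r))))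
  one : M (fromℕ (suc m)) (fromℕ (suc m)) ≡ + 1
  one = trans (last (fromℕ (suc m)) (suc m) (toℕ-fromℕ (suc m))) (cong +_ (nCn≡1 (suc m + suc m)))
  corner : ∀ r s → M (inject₁ r) (inject₁ s) ≡ + binom (suc m + toℕ r) (2 * toℕ s)
  corner r s = trans (entry (inject₁ r) (inject₁ s))
    (trans (cong₂ (λ x y → + ((suc m + x) C (2 * y))) (toℕ-inject₁ r) (toℕ-inject₁ s))
      (cong +_ (sym (binom≡C (suc m + toℕ r) (2 * toℕ s)))))

-- Powers of two and the closed form

triangle : ℕ → ℕ
triangle d = d * (d ∸ 1) / 2

triangle-suc : ∀ m → triangle (suc (suc m)) ≡ suc m + triangle (suc m)
triangle-suc m = begin
  (suc (suc m) * suc m) / 2             ≡⟨ cong (_/ 2) (split m) ⟩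
  -- Floor division distributes here because 2 divides the second summand.
  (suc m * m + suc m * 2) / 2           ≡⟨ +-distrib-/-∣ʳ (suc m * m) (divides-refl (suc m)) ⟩
  suc m * m / 2 + suc m * 2 / 2         ≡⟨ cong (λ t → suc m * m / 2 + t) (m*n/n≡m (suc m) 2) ⟩
  suc m * m / 2 + suc m                 ≡⟨ ℕₚ.+-comm (suc m * m / 2) (suc m) ⟩
  suc m + suc m * m / 2                 ∎
  where
  split : ∀ m → suc (suc m) * suc m ≡ suc m * m + suc m * 2
  split = ℕ-Solver.solve-∀

D-bottom : ∀ m → D (suc m) 0 ≡ + (2 ^ triangle (suc m))
D-bottom zero = refl
D-bottom (suc m) = begin
  D (suc (suc m)) 0                                              ≡⟨ sym (ℤₚ.*-identityˡ (D (suc (suc m)) 0)) ⟩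
  -- The factor 1 is the leading weight, so `D-ratio` at i = d compares D_{d,0} with D_{d,d}.
  + 1 ℤ.* D (suc (suc m)) 0                                      ≡⟨ cong (λ t → + t ℤ.* D (suc (suc m)) 0) (sym (weight-top (suc m))) ⟩
  + weight (suc m) (suc (suc m)) ℤ.* D (suc (suc m)) 0           ≡⟨ sym (D-ratio (suc m) (suc (suc m)) ℕₚ.≤-refl) ⟩
  + weight (suc m) 0 ℤ.* D (suc (suc m)) (suc (suc m))           ≡⟨ cong₂ (λ x y → + x ℤ.* y) (weight-0 (suc m)) (trans (D-top m) (D-bottom m)) ⟩
  + (2 ^ suc m) ℤ.* + (2 ^ triangle (suc m))                         ≡⟨ sym (ℤₚ.pos-* (2 ^ suc m) (2 ^ triangle (suc m))) ⟩
  + (2 ^ suc m * 2 ^ triangle (suc m))                           ≡⟨ cong +_ (sym (ℕₚ.^-distribˡ-+-* 2 (suc m) (triangle (suc m)))) ⟩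
  + (2 ^ (suc m + triangle (suc m)))                               ≡⟨ cong (λ t → + (2 ^ t)) (sym (triangle-suc m)) ⟩
  + (2 ^ triangle (suc (suc m)))                                   ∎

-- The factor d 2^i is moved to the left, since d(d-1)/2 - i can be negative, as for d = i = 1.
theorem2 : (d i : ℕ) → 1 ≤ d → i ≤ d →
    + (d * 2 ^ i) ℤ.* D d i ≡ + (2 ^ ((d * (d ∸ 1)) / 2) * (d C i) * (d + i))
-- Both sides are multiplied by 2^m, which is `weight m 0`, so that `D-ratio` applies;
-- `weight-closed` yields the same factor on the right.
theorem2 (suc m) i _ i≤d = ℤₚ.*-cancelˡ-≡ (+ (2 ^ m)) _ _ {{ℕₚ.m^n≢0 2 m}} (begin
  + (2 ^ m) ℤ.* (+ (suc m * 2 ^ i) ℤ.* D (suc m) i)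
    ≡⟨ exchange (+ (2 ^ m)) (+ (suc m * 2 ^ i)) (D (suc m) i) ⟩
  + (suc m * 2 ^ i) ℤ.* (+ (2 ^ m) ℤ.* D (suc m) i)
    ≡⟨ cong (λ t → + (suc m * 2 ^ i) ℤ.* (+ t ℤ.* D (suc m) i)) (sym (weight-0 m)) ⟩
  + (suc m * 2 ^ i) ℤ.* (+ weight m 0 ℤ.* D (suc m) i)
    ≡⟨ cong (+ (suc m * 2 ^ i) ℤ.*_) (trans (D-ratio m i i≤d) (cong (+ weight m i ℤ.*_) (D-bottom m))) ⟩
  + (suc m * 2 ^ i) ℤ.* (+ weight m i ℤ.* + (2 ^ triangle (suc m)))
    ≡⟨ sym (ℤₚ.*-assoc (+ (suc m * 2 ^ i)) (+ weight m i) (+ (2 ^ triangle (suc m)))) ⟩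
  + (suc m * 2 ^ i) ℤ.* + weight m i ℤ.* + (2 ^ triangle (suc m))
    ≡⟨ cong (ℤ._* + (2 ^ triangle (suc m))) (sym (ℤₚ.pos-* (suc m * 2 ^ i) (weight m i))) ⟩
  + (suc m * 2 ^ i * weight m i) ℤ.* + (2 ^ triangle (suc m))
    ≡⟨ sym (ℤₚ.pos-* (suc m * 2 ^ i * weight m i) (2 ^ triangle (suc m))) ⟩
  + (suc m * 2 ^ i * weight m i * 2 ^ triangle (suc m))
    ≡⟨ cong (λ t → + (t * 2 ^ triangle (suc m))) (weight-closed m i) ⟩
  + (2 ^ m * ((suc m C i) * (suc m + i)) * 2 ^ triangle (suc m))
    ≡⟨ cong +_ (regroup (2 ^ m) (suc m C i) (suc m + i) (2 ^ triangle (suc m))) ⟩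
  + (2 ^ m * (2 ^ triangle (suc m) * (suc m C i) * (suc m + i)))
    ≡⟨ ℤₚ.pos-* (2 ^ m) (2 ^ triangle (suc m) * (suc m C i) * (suc m + i)) ⟩
  + (2 ^ m) ℤ.* + (2 ^ triangle (suc m) * (suc m C i) * (suc m + i)) ∎)
  where
  exchange : ∀ x y z → x ℤ.* (y ℤ.* z) ≡ y ℤ.* (x ℤ.* z)
  exchange = solve-∀
  regroup : ∀ p c k t → p * (c * k) * t ≡ p * (t * c * k)
  regroup = ℕ-Solver.solve-∀
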